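{- Let $n$ be a nonnegative integer. There is an irreducible overlap-free binary word of length $n$ if and only if $n \in \{6, 8, 9, 10\} \cup \{m \mid m \geq 12\}$.
   Context: Words are finite strings over the binary alphabet $\{0,1\}$. A factor of a word is a contiguous subword. An overlap is a word of the form $xYxYx$ where $x$ is a letter and $Y$ is a (possibly empty) word; a word is overlap-free if none of its factors is an overlap. A letter of a word is interior if it is neither the first nor the last letter of the word. An irreducible overlap-free word is an overlap-free word of length at least $3$ such that removing any one of its interior letters yields a word containing an overlap as a factor. -}

module Defs where

open import Data.Bool using (Bool)
open import Data.List using (List; []; _∷_; _++_; [_]; length)
open import Data.Nat using (ℕ; _≤_; _≥_)
open import Data.Product using (Σ; ∃; _×_; _,_)
open import Relation.Binary.PropositionalEquality using (_≡_; _≢_)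
open import Relation.Nullary using (¬_)

Word : Set
Word = List Bool

Factor : Word → Word → Set
Factor f w = ∃ λ u → ∃ λ v → w ≡ u ++ f ++ v

IsOverlap : Word → Set
IsOverlap f = ∃ λ (x : Bool) → ∃ λ (Y : Word) → f ≡ x ∷ Y ++ x ∷ Y ++ [ x ]

ContainsOverlap : Word → Set
ContainsOverlap w = ∃ λ f → Factor f w × IsOverlap f

OverlapFree : Word → Set
OverlapFree w = ¬ ContainsOverlap w

DeleteInterior : Word → Word → Set
DeleteInterior w w' =
  ∃ λ u → ∃ λ (a : Bool) → ∃ λ v →
    u ≢ [] × v ≢ [] × w ≡ u ++ a ∷ v × w' ≡ u ++ v

IrreducibleOverlapFree : Word → Set
IrreducibleOverlapFree w =
  OverlapFree w × length w ≥ 3 ×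
  (∀ w' → DeleteInterior w w' → ContainsOverlap w')

module Submission where

-- Deleting a letter of the Thue–Morse sequence T creates an overlap within distance 4, so whether
-- the factor of T from position i to position i + n is irreducible depends only on letters near
-- its two ends.  A start r + 8k with r ∈ {0,3,4,7} is good as soon as T k = T (k + 1), and an end
-- 8 (k' + 1) + s with s ∈ {0,6} is good as soon as T k' ≠ T (k' + 1).  Every distance e = k' - k ≥ 1
-- occurs between such k and k', and the differences 8e + 8 + s - r cover all n ≥ 12 except 14.
-- The remaining lengths, and the impossible ones below 12, are finite computations.

open import Defs
open import Data.Bool using (Bool; true; false; not; _xor_)
open import Data.Bool.Properties using (_≟_; not-involutive; not-injective; not-¬)
open import Data.Fin using (Fin; toℕ)
open import Data.Fin.Patterns using (0F; 1F; 2F; 3F; 4F; 5F; 6F; 7F)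
open import Data.Fin.Properties using (toℕ<n) renaming (all? to allFin?)
open import Data.List using (List; []; _∷_; _++_; [_]; length; take; drop; map)
open import Data.List.Membership.Propositional using (_∈_)
open import Data.List.Membership.Propositional.Properties using (∈-map⁺; ∈-++⁺ˡ; ∈-++⁺ʳ)
open import Data.List.Properties using (length-++; ++-assoc; ∷-injective)
open import Data.List.Relation.Binary.Pointwise using (Pointwise-≡⇒≡; ≡⇒Pointwise-≡)
open import Data.List.Relation.Binary.Prefix.Heterogeneous using (Prefix; PrefixView; toView; fromView) renaming (_++_ to _followedBy_)
open import Data.List.Relation.Binary.Prefix.Heterogeneous.Properties using (prefix?)
open import Data.List.Relation.Unary.All as All using (All; all?)
open import Data.List.Relation.Unary.Any using (here)
open import Data.Nat using (ℕ; zero; suc; _+_; _*_; _∸_; _≤_; _<_; _≥_; z≤n; s≤s; _≤?_; ⌊_/2⌋)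
open import Data.Nat.DivMod using (_divMod_; result)
open import Data.Nat.Induction using (<-rec)
open import Data.Nat.Properties hiding (_≟_)
open import Data.Nat.Tactic.RingSolver using (solve-∀)
open import Data.Product using (∃; ∃₂; _×_; _,_; proj₁; proj₂)
open import Data.Sum using (_⊎_; inj₁; inj₂)
open import Function using (_∘_; case_of_)
open import Function.Bundles using (_⇔_; mk⇔)
open import Relation.Binary.PropositionalEquality using (_≡_; refl; sym; trans; cong; cong₂; subst)
open import Relation.Nullary using (¬_; Dec; no; contradiction)
open import Relation.Nullary.Decidable using (map′; _×-dec_; _⊎-dec_; ¬?; from-yes)

-- Deciding whether a word contains an overlap.

OverlapPrefix : Word → Set
OverlapPrefix w = ∃ λ x → ∃ λ Y → ∃ λ v → w ≡ x ∷ Y ++ x ∷ Y ++ x ∷ v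

regroup : ∀ (Y : Word) x v → (Y ++ x ∷ Y ++ [ x ]) ++ v ≡ Y ++ x ∷ Y ++ x ∷ v
regroup Y x v = trans (++-assoc Y _ v) (cong (λ z → Y ++ x ∷ z) (++-assoc Y [ x ] v))

take-length-++ : (u v : Word) → take (length u) (u ++ v) ≡ u
take-length-++ []      v = refl
take-length-++ (x ∷ u) v = cong (x ∷_) (take-length-++ u v)

-- In an overlap that starts the word, `Y` must be the stretch right after the first letter. Only
-- its length is unknown, so a bounded search suffices.
overlapPrefix? : ∀ w → Dec (OverlapPrefix w)
overlapPrefix? []      = no λ { (_ , _ , _ , ()) }
overlapPrefix? (x ∷ w) =
  map′ sound complete (anyUpTo? (λ p → prefix? _≟_ (take p w ++ x ∷ take p w ++ [ x ]) w) (length w))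
  where
  fromPrefix : ∀ {Y w} → PrefixView _≡_ (Y ++ x ∷ Y ++ [ x ]) w → OverlapPrefix (x ∷ w)
  fromPrefix {Y} (eq followedBy v) with refl ← Pointwise-≡⇒≡ eq = x , Y , v , cong (x ∷_) (regroup Y x v)

  sound : (∃ λ p → p < length w × Prefix _≡_ (take p w ++ x ∷ take p w ++ [ x ]) w) →
          OverlapPrefix (x ∷ w)
  sound (p , _ , pre) = fromPrefix {take p w} (toView pre)

  complete : OverlapPrefix (x ∷ w) →
             ∃ λ p → p < length w × Prefix _≡_ (take p w ++ x ∷ take p w ++ [ x ]) w
  complete (_ , Y , v , refl) =
    length Y ,
    subst (length Y <_) (sym (length-++ Y)) (m<m+n (length Y) (s≤s z≤n)) ,
    subst (λ Z → Prefix _≡_ (Z ++ x ∷ Z ++ [ x ]) w) (sym (take-length-++ Y _))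
      (subst (Prefix _≡_ _) (regroup Y x v) (fromView (≡⇒Pointwise-≡ refl followedBy v)))

containsOverlap-++ : ∀ p {w} s → ContainsOverlap w → ContainsOverlap (p ++ w ++ s)
containsOverlap-++ p s (f , (u , v , refl) , o) = f , (p ++ u , v ++ s , eq) , o
  where
  eq : p ++ (u ++ f ++ v) ++ s ≡ (p ++ u) ++ f ++ (v ++ s)
  eq = trans (cong (p ++_) (trans (++-assoc u (f ++ v) s) (cong (u ++_) (++-assoc f v s))))
             (sym (++-assoc p u _))

overlapPrefix⇒containsOverlap : ∀ {w} → OverlapPrefix w → ContainsOverlap w
overlapPrefix⇒containsOverlap (x , Y , v , refl) =
  _ , ([] , v , cong (x ∷_) (sym (regroup Y x v)))
    , (x , Y , refl)

containsOverlap-∷⁻ : ∀ {x w} → ContainsOverlap (x ∷ w) → OverlapPrefix (x ∷ w) ⊎ ContainsOverlap w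
containsOverlap-∷⁻ (_ , ([] , v , eq) , (x , Y , refl)) =
  inj₁ (x , Y , v , trans eq (cong (x ∷_) (regroup Y x v)))
containsOverlap-∷⁻ (f , (_ ∷ u , v , refl) , o) = inj₂ (f , (u , v , refl) , o)

containsOverlap-∷⁺ : ∀ {x w} → OverlapPrefix (x ∷ w) ⊎ ContainsOverlap w → ContainsOverlap (x ∷ w)
containsOverlap-∷⁺ (inj₁ p) = overlapPrefix⇒containsOverlap p
containsOverlap-∷⁺ {x} (inj₂ (f , (u , v , refl) , o)) = f , (x ∷ u , v , refl) , o

containsOverlap? : ∀ w → Dec (ContainsOverlap w)
containsOverlap? []      = no λ { (_ , ([] , _ , ()) , (_ , _ , refl)) ; (_ , (_ ∷ _ , _ , ()) , _) }
containsOverlap? (x ∷ w) =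
  map′ containsOverlap-∷⁺ containsOverlap-∷⁻ (overlapPrefix? (x ∷ w) ⊎-dec containsOverlap? w)

-- Deletion by position and decidability of irreducibility.

del : ℕ → Word → Word
del _       []      = []
del zero    (x ∷ w) = w
del (suc j) (x ∷ w) = x ∷ del j w

del-++ˡ : ∀ p j w → del (length p + j) (p ++ w) ≡ p ++ del j w
del-++ˡ []      j w = refl
del-++ˡ (x ∷ p) j w = cong (x ∷_) (del-++ˡ p j w)

del-++ʳ : ∀ j w s → j < length w → del j (w ++ s) ≡ del j w ++ s
del-++ʳ zero    (x ∷ w) s _       = refl
del-++ʳ (suc j) (x ∷ w) s (s≤s h) = cong (x ∷_) (del-++ʳ j w s h)

containsOverlap-del-++ : ∀ p {w} s j → j < length w → ContainsOverlap (del j w) →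
                         ContainsOverlap (del (length p + j) (p ++ w ++ s))
containsOverlap-del-++ p {w} s j h c =
  subst ContainsOverlap
    (sym (trans (del-++ˡ p j (w ++ s)) (cong (p ++_) (del-++ʳ j w s h))))
    (containsOverlap-++ p s c)

-- Counting `suc j` letters before the deleted one and `suc k` after it expresses interiority
-- without subtraction and lets later arguments count from either end.
deleteInterior⇒del : ∀ {w w'} → DeleteInterior w w' →
                     ∃₂ λ j k → suc j + suc (suc k) ≡ length w × w' ≡ del (suc j) w
deleteInterior⇒del ([] , a , v , u≢[] , _) = contradiction refl u≢[]
deleteInterior⇒del (x ∷ u , a , [] , _ , v≢[] , _) = contradiction refl v≢[]
deleteInterior⇒del (x ∷ u , a , y ∷ v , _ , _ , refl , refl) =
  length u , length v , cong suc (sym (length-++ u)) ,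
  cong (x ∷_) (sym (trans (cong (λ l → del l (u ++ a ∷ y ∷ v)) (sym (+-identityʳ (length u))))
                          (del-++ˡ u 0 (a ∷ y ∷ v))))

del⇒deleteInterior : ∀ j w → suc (suc j) < length w → DeleteInterior w (del (suc j) w)
del⇒deleteInterior zero    (x ∷ a ∷ y ∷ v) _ = [ x ] , a , y ∷ v , (λ ()) , (λ ()) , refl , refl
del⇒deleteInterior zero    (x ∷ a ∷ [])    (s≤s (s≤s ()))
del⇒deleteInterior zero    (x ∷ [])        (s≤s ())
del⇒deleteInterior (suc j) (x ∷ w) (s≤s h) with del⇒deleteInterior j w h
... | u , a , v , _ , v≢[] , eq , eq' =
  x ∷ u , a , v , (λ ()) , v≢[] , cong (x ∷_) eq , cong (x ∷_) eq'

irreducible⁺ : ∀ {w} → OverlapFree w → length w ≥ 3 →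
               (∀ j k → suc j + suc (suc k) ≡ length w → ContainsOverlap (del (suc j) w)) →
               IrreducibleOverlapFree w
irreducible⁺ free long dels = free , long , λ w' d → case deleteInterior⇒del d of
  λ { (j , k , eq , refl) → dels j k eq }

irreducible? : ∀ w → Dec (IrreducibleOverlapFree w)
irreducible? w =
  map′ (λ (free , long , dels) → irreducible⁺ free long λ j k eq → dels (bound j k eq))
       (λ (free , long , dels) → free , long , λ {j} h → dels _ (del⇒deleteInterior j w (bound' j long h)))
       -- There are `length w ∸ 2` interior letters; the index `j` stands for position `suc j`.
       (¬? (containsOverlap? w) ×-dec (3 ≤? length w) ×-dec
        allUpTo? (λ j → containsOverlap? (del (suc j) w)) (length w ∸ 2))
  where
  bound : ∀ j k → suc j + suc (suc k) ≡ length w → j < length w ∸ 2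
  bound j k eq = subst (λ n → j < n ∸ 2) eq
    (subst (λ n → j < n ∸ 1) (sym (+-suc j (suc k))) (m<m+n j (s≤s z≤n)))

  bound' : ∀ j → length w ≥ 3 → j < length w ∸ 2 → suc (suc j) < length w
  bound' j long h = subst (_≤ length w) (+-comm (suc j) 2)
    (m≤o∸n⇒m+n≤o (suc j) (≤-trans (n≤1+n 2) long) h)

-- Exhaustive search over the words of a given length.

words : ℕ → List Word
words zero    = [ [] ]
words (suc n) = map (true ∷_) (words n) ++ map (false ∷_) (words n)

∈-words : ∀ w → w ∈ words (length w)
∈-words []          = here refl
∈-words (true  ∷ w) = ∈-++⁺ˡ (∈-map⁺ (true ∷_) (∈-words w))
∈-words (false ∷ w) = ∈-++⁺ʳ (map (true ∷_) (words (length w))) (∈-map⁺ (false ∷_) (∈-words w))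

Realisable : ℕ → Set
Realisable n = ∃ λ w → IrreducibleOverlapFree w × length w ≡ n

noIrreducible? : ∀ n → Dec (All (¬_ ∘ IrreducibleOverlapFree) (words n))
noIrreducible? n = all? (¬? ∘ irreducible?) (words n)

¬realisable : ∀ {n} → All (¬_ ∘ IrreducibleOverlapFree) (words n) → ¬ Realisable n
¬realisable none (w , irr , refl) = All.lookup none (∈-words w) irr

-- The Thue-Morse sequence and its recursion.

-- Doubling is written `k * 2` because `suc k * 2` then reduces to `suc (suc (k * 2))`.
data Half : ℕ → Set where
  even : ∀ k → Half (k * 2)
  odd  : ∀ k → Half (suc (k * 2))

half : ∀ n → Half n
half zero = even 0
half (suc n) with half n
... | even k = odd k
... | odd k  = even (suc k)

isOdd : ℕ → Bool
isOdd zero    = false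
isOdd (suc n) = not (isOdd n)

-- The number of ones in the binary expansion of n, mod 2; the first argument is fuel, any value
-- ≥ n being enough.
parity : ℕ → ℕ → Bool
parity zero    n = false
parity (suc f) n = isOdd n xor parity f ⌊ n /2⌋

T : ℕ → Bool
T n = parity n n

parity-fuel : ∀ f n → n ≤ f → parity f n ≡ parity (suc f) n
parity-fuel zero    zero    _ = refl
parity-fuel (suc f) n       h =
  cong (isOdd n xor_) (parity-fuel f ⌊ n /2⌋ (≤-trans (⌊n/2⌋-mono h) (⌊n/2⌋-suc f)))
  where
  ⌊n/2⌋-suc : ∀ f → ⌊ suc f /2⌋ ≤ f
  ⌊n/2⌋-suc f = ≤-pred (⌊n/2⌋<n f)

parity-≥ : ∀ d n → parity (d + n) n ≡ T n
parity-≥ zero    n = refl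
parity-≥ (suc d) n = trans (sym (parity-fuel (d + n) n (m≤n+m n d))) (parity-≥ d n)

-- The fuel left for `⌊ n /2⌋` exceeds what `T` supplies, and surplus fuel is harmless by
-- `parity-≥`.
T-step : ∀ n → T n ≡ isOdd n xor T ⌊ n /2⌋
T-step n = trans (parity-fuel n n ≤-refl)
  (cong (isOdd n xor_) (trans (cong (λ f → parity f ⌊ n /2⌋) (sym (m∸n+n≡m (⌊n/2⌋≤n n))))
                              (parity-≥ (n ∸ ⌊ n /2⌋) ⌊ n /2⌋)))

isOdd-even : ∀ k → isOdd (k * 2) ≡ false
isOdd-even zero    = refl
isOdd-even (suc k) = trans (not-involutive _) (isOdd-even k)

⌊k*2/2⌋ : ∀ k → ⌊ k * 2 /2⌋ ≡ k
⌊k*2/2⌋ zero    = refl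
⌊k*2/2⌋ (suc k) = cong suc (⌊k*2/2⌋ k)

⌊1+k*2/2⌋ : ∀ k → ⌊ suc (k * 2) /2⌋ ≡ k
⌊1+k*2/2⌋ zero    = refl
⌊1+k*2/2⌋ (suc k) = cong suc (⌊1+k*2/2⌋ k)

T-even : ∀ k → T (k * 2) ≡ T k
T-even k = trans (T-step (k * 2)) (cong₂ _xor_ (isOdd-even k) (cong T (⌊k*2/2⌋ k)))

T-odd : ∀ k → T (suc (k * 2)) ≡ not (T k)
T-odd k = trans (T-step (suc (k * 2))) (cong₂ (λ b n → not b xor T n) (isOdd-even k) (⌊1+k*2/2⌋ k))

-- Overlap-freeness of the Thue-Morse sequence.

-- One of the two numbers is even, and `T` always changes from `k * 2` to its successor.
isOdd⇒flip : ∀ m n → isOdd (m + n) ≡ true → T (suc m) ≡ not (T m) ⊎ T (suc n) ≡ not (T n)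
isOdd⇒flip m n h with half m | half n
... | even k | _      = inj₁ (trans (T-odd k) (cong not (sym (T-even k))))
... | odd k  | even l = inj₂ (trans (T-odd l) (cong not (sym (T-even l))))
... | odd k  | odd l  =
  contradiction (trans (sym h) (trans (cong isOdd (sum k l)) (isOdd-even (suc (k + l))))) λ ()
  where
  sum : ∀ k l → suc (k * 2) + suc (l * 2) ≡ suc (k + l) * 2
  sum = solve-∀

-- An overlap of period p in the Thue–Morse sequence, starting at position i.
Repeats : ℕ → ℕ → Set
Repeats i p = ∀ {j} → j ≤ p → T (j + i) ≡ T (j + (p + i))

-- One of j + i and j + p + i is even, where T changes, so T alternates along the whole period.
¬Repeats-odd : ∀ i q → ¬ Repeats i (suc (q * 2))
¬Repeats-odd i q rep = not-¬ {T i} refl (trans (rep z≤n) endpoint)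
  where
  p = suc (q * 2)

  flip : ∀ {j} → j < p → T (suc j + i) ≡ not (T (j + i))
  flip {j} h with isOdd⇒flip (j + i) (j + (p + i)) oddSum
    where
    sum : ∀ j q i → (j + i) + (j + (suc (q * 2) + i)) ≡ suc ((j + i + q) * 2)
    sum = solve-∀
    oddSum : isOdd ((j + i) + (j + (p + i))) ≡ true
    oddSum = trans (cong isOdd (sum j q i)) (cong not (isOdd-even (j + i + q)))
  ... | inj₁ e = e
  -- The change happens in the second copy of the period and is carried back by the repetition.
  ... | inj₂ e = trans (rep h) (trans e (cong not (sym (rep (<⇒≤ h)))))

  alternates : ∀ j → j ≤ q → T (j * 2 + i) ≡ T i
  alternates zero    _ = refl
  alternates (suc j) h =
    trans (flip {suc (j * 2)} (m≤n⇒m≤1+n h'))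
    (trans (cong not (flip {j * 2} (<⇒≤ (m≤n⇒m≤1+n h'))))
    (trans (not-involutive _) (alternates j (<⇒≤ h))))
    where
    h' : suc (j * 2) < q * 2
    h' = *-monoˡ-≤ 2 h

  -- An odd number of changes separates the two ends of the period, while `rep` at zero makes them
  -- equal.
  endpoint : T (p + i) ≡ not (T i)
  endpoint = trans (flip {q * 2} ≤-refl) (cong not (alternates q ≤-refl))

T-double-sum : ∀ j n → T (j * 2 + n * 2) ≡ T (j + n)
T-double-sum j n = trans (cong T (sym (*-distribʳ-+ 2 j n))) (T-even (j + n))

T-suc-double-sum : ∀ j n → T (j * 2 + suc (n * 2)) ≡ not (T (j + n))
T-suc-double-sum j n =
  trans (cong T (trans (+-suc (j * 2) (n * 2)) (cong suc (sym (*-distribʳ-+ 2 j n))))) (T-odd (j + n))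

-- Reading every second letter of the overlap gives `T` again, up to complement when `i` is odd, so
-- the period halves.
Repeats-half : ∀ i q → Repeats i (q * 2) → ∃ λ k → Repeats k q
Repeats-half i q rep with half i
... | even k = k , λ {j} h →
  trans (sym (T-double-sum j k)) (trans (rep (*-monoˡ-≤ 2 h))
    (trans (cong (λ n → T (j * 2 + n)) (sym (*-distribʳ-+ 2 q k))) (T-double-sum j (q + k))))
... | odd k = k , λ {j} h → not-injective
  (trans (sym (T-suc-double-sum j k)) (trans (rep (*-monoˡ-≤ 2 h))
    (trans (cong (λ n → T (j * 2 + n)) (trans (+-suc (q * 2) (k * 2)) (cong suc (sym (*-distribʳ-+ 2 q k)))))
           (T-suc-double-sum j (q + k)))))

-- Descent on the period: odd periods are impossible and even ones halve. The parity of `suc p` is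
-- opposite to that of `p`.
¬Repeats : ∀ p i → ¬ Repeats i (suc p)
¬Repeats = <-rec (λ p → ∀ i → ¬ Repeats i (suc p)) λ p rec i rep → step p rec i rep
  where
  step : ∀ p → (∀ {q} → q < p → ∀ i → ¬ Repeats i (suc q)) → ∀ i → ¬ Repeats i (suc p)
  step p rec i rep with half p
  ... | even q = ¬Repeats-odd i q rep
  ... | odd q  with Repeats-half i (suc q) rep
  ... | k , rep' = rec (s≤s (m≤m*n q 2)) k rep'

seg : ℕ → ℕ → Word
seg i zero    = []
seg i (suc n) = T i ∷ seg (suc i) n

length-seg : ∀ i n → length (seg i n) ≡ n
length-seg i zero    = refl
length-seg i (suc n) = cong suc (length-seg (suc i) n)

seg-++ : ∀ i m n → seg i (m + n) ≡ seg i m ++ seg (m + i) n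
seg-++ i zero    n = refl
seg-++ i (suc m) n = cong (T i ∷_) (trans (seg-++ (suc i) m n)
  (cong (λ k → seg (suc i) m ++ seg k n) (+-suc m i)))

seg-++⁻ : ∀ i n u v → seg i n ≡ u ++ v → u ≡ seg i (length u) × v ≡ seg (length u + i) (length v)
seg-++⁻ i n       []      v refl = refl , cong (seg i) (sym (length-seg i n))
seg-++⁻ i (suc n) (x ∷ u) v eq with ∷-injective eq
... | refl , eq' with seg-++⁻ (suc i) n u v eq'
... | eq₁ , eq₂ = cong (T i ∷_) eq₁ , trans eq₂ (cong (λ k → seg k (length v)) (+-suc (length u) i))

seg-injective : ∀ i k {n j} → seg i n ≡ seg k n → j < n → T (j + i) ≡ T (j + k)
seg-injective i k {suc n} {zero}  eq _       = proj₁ (∷-injective eq)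
seg-injective i k {suc n} {suc j} eq (s≤s h) =
  trans (cong T (sym (+-suc j i))) (trans (seg-injective (suc i) (suc k) (proj₂ (∷-injective eq)) h)
        (cong T (+-suc j k)))

-- In an overlap `xYxYx` the word `xYx` occurs twice, at distance `suc (length Y)`; comparing both
-- occurrences with `T` gives a repetition.
seg-overlapFree : ∀ i n → OverlapFree (seg i n)
seg-overlapFree i n (_ , (u , v , eq) , (x , Y , refl)) = ¬Repeats (length Y) k repeats
  where
  k = length u + i
  f = x ∷ Y ++ x ∷ Y ++ [ x ]
  f≡ : f ≡ seg k (length f)
  f≡ = proj₁ (seg-++⁻ k _ f v (sym (proj₂ (seg-++⁻ i n u (f ++ v) eq))))
  X : Word
  X = x ∷ Y ++ [ x ]
  len : length X ≡ suc (suc (length Y))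
  len = cong suc (trans (length-++ Y) (+-comm (length Y) 1))
  second : X ≡ seg (suc (length Y) + k) (length X)
  second = proj₂ (seg-++⁻ k _ (x ∷ Y) X (sym f≡))
  first : X ≡ seg k (length X)
  first = proj₁ (seg-++⁻ k _ X (Y ++ [ x ]) (trans (sym f≡) (cong (x ∷_) (sym (++-assoc Y [ x ] _)))))
  repeats : Repeats k (suc (length Y))
  repeats {j} h =
    seg-injective k (suc (length Y) + k) {j = j} (trans (sym first) second) (subst (j <_) (sym len) (s≤s h))

-- Equal and unequal neighbours at a prescribed distance.

-- With `T-4mod4`, the neighbours at `k` and `suc k` reappear at the border between two blocks of
-- length four, which preserves equality and change alike.
T-3mod4 : ∀ k → T (3 + k * 2 * 2) ≡ T k
T-3mod4 k = trans (T-odd (suc (k * 2))) (trans (cong not (T-odd k)) (not-involutive (T k)))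

T-4mod4 : ∀ k → T (4 + k * 2 * 2) ≡ T (suc k)
T-4mod4 k = trans (T-even (suc k * 2)) (T-even (suc k))

Changes : ℕ → Set
Changes k = T (suc k) ≡ not (T k)

changes-even : ∀ k → Changes (k * 2)
changes-even k = trans (T-odd k) (cong not (sym (T-even k)))

changes-3mod8 : ∀ k → Changes (3 + k * 2 * 2 * 2)
changes-3mod8 k = trans (T-4mod4 (k * 2)) (trans (changes-even k) (cong not (sym (T-3mod4 (k * 2)))))

-- Unless `e` is a multiple of 4, a fixed `k` works; for multiples of 4 the solution for `e` divided
-- by 4 is lifted.
stays-and-changes : ∀ e → 1 ≤ e → ∃ λ k → T (suc k) ≡ T k × Changes (k + e)
stays-and-changes = <-rec _ λ e rec → step e rec
  where
  P : ℕ → Set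
  P e = ∃ λ k → T (suc k) ≡ T k × Changes (k + e)

  step : ∀ e → (∀ {g} → g < e → 1 ≤ g → P g) → 1 ≤ e → P e
  step e rec pos with half e
  -- The witnesses 1 and 5 satisfy `T 1 ≡ T 2` and `T 5 ≡ T 6`. For `e` odd, `1 + e` is even; for
  -- `e` equal to 2 or 6 modulo 8, adding 1 or 5 gives 3 modulo 8.
  ... | odd d  = 1 , refl , changes-even (suc d)
  ... | even d with half d
  ... | odd g with half g
  ... | even h = 1 , refl , changes-3mod8 h
  ... | odd h  = 5 , refl , changes-3mod8 (suc h)
  step e rec pos | even _ | even zero with () ← pos
  step e rec pos | even _ | even (suc g) with rec (lemma g) (s≤s z≤n)
    where
    lemma : ∀ g → suc g < suc g * 2 * 2
    lemma g = <-trans (m<m*n (suc g) 2 ≤-refl) (m<m*n (suc g * 2) 2 ≤-refl)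
  -- The map sending `k` to `3 + 4k` keeps both properties and multiplies the distance by 4.
  ... | k , stay , change = 3 + k * 2 * 2 ,
    trans (T-4mod4 k) (trans stay (sym (T-3mod4 k))) ,
    subst Changes (cong (3 +_) (distrib k (suc g)))
      (trans (T-4mod4 (k + suc g)) (trans change (cong not (sym (T-3mod4 (k + suc g))))))
    where
    distrib : ∀ k g → (k + g) * 2 * 2 ≡ k * 2 * 2 + g * 2 * 2
    distrib = solve-∀

-- The Thue-Morse morphism and blocks of length eight.

μ : Word → Word
μ []      = []
μ (x ∷ w) = x ∷ not x ∷ μ w

seg-μ : ∀ k n → seg (k * 2) (n * 2) ≡ μ (seg k n)
seg-μ k zero    = refl
seg-μ k (suc n) = cong₂ _∷_ (T-even k) (cong₂ _∷_ (T-odd k) (seg-μ (suc k) n))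

-- Three applications of the morphism turn each letter into a block of eight, so sixteen letters of
-- `T` are determined by two.
blocks : Bool → Bool → Word
blocks x y = μ (μ (μ (x ∷ y ∷ [])))

seg-blocks : ∀ k → seg (k * 8) 16 ≡ blocks (T k) (T (suc k))
seg-blocks k = trans (cong (λ i → seg i 16) (sym (trans (*-assoc (k * 2) 2 2) (*-assoc k 2 4))))
  (trans (seg-μ (k * 2 * 2) 8) (cong μ (trans (seg-μ (k * 2) 4) (cong μ (seg-μ k 2)))))

take-seg : ∀ i {m n} → m ≤ n → take m (seg i n) ≡ seg i m
take-seg i z≤n     = refl
take-seg i (s≤s h) = cong (T i ∷_) (take-seg (suc i) h)

drop-seg : ∀ i m n → drop m (seg i (m + n)) ≡ seg (m + i) n
drop-seg i zero    n = refl
drop-seg i (suc m) n = trans (drop-seg (suc i) m n) (cong (λ k → seg k n) (+-suc m i))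

-- Overlaps created by deleting a letter away from the ends.

del-window : ∀ i a m b {j} → j < m → ContainsOverlap (del j (seg (a + i) m)) →
             ContainsOverlap (del (a + j) (seg i (a + (m + b))))
del-window i a m b {j} h c =
  subst ContainsOverlap
    (trans (cong (λ l → del (l + j) (seg i a ++ seg (a + i) m ++ seg (m + (a + i)) b)) (length-seg i a))
           (cong (del (a + j)) (sym (trans (seg-++ i a (m + b)) (cong (seg i a ++_) (seg-++ (a + i) m b))))))
    (containsOverlap-del-++ (seg i a) (seg (m + (a + i)) b) j
      (subst (j <_) (sym (length-seg (a + i) m)) h) c)

middle? : ∀ x y → Dec (∀ (ρ : Fin 8) → ContainsOverlap (del 4 (take 9 (drop (toℕ ρ) (blocks x y)))))
middle? x y = allFin? λ ρ → containsOverlap? (del 4 (take 9 (drop (toℕ ρ) (blocks x y))))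

-- The deleted letter is the centre of a nine-letter window. Any such window of `T` lies in two
-- consecutive blocks, starting at an offset below 8.
middle : ∀ x y (ρ : Fin 8) → ContainsOverlap (del 4 (take 9 (drop (toℕ ρ) (blocks x y))))
middle true  true  = from-yes (middle? true true)
middle true  false = from-yes (middle? true false)
middle false true  = from-yes (middle? false true)
middle false false = from-yes (middle? false false)

seg-middle : ∀ q → ContainsOverlap (del 4 (seg q 9))
seg-middle q with q divMod 8
... | result k ρ refl = subst (λ w → ContainsOverlap (del 4 w)) window (middle (T k) (T (suc k)) ρ)
  where
  r = toℕ ρ
  window : take 9 (drop r (blocks (T k) (T (suc k)))) ≡ seg (r + k * 8) 9
  window = trans (cong (take 9 ∘ drop r)
      (trans (sym (seg-blocks k)) (cong (seg (k * 8)) (sym (m+[n∸m]≡n {r} (≤-trans (<⇒≤ (toℕ<n ρ)) (m≤m+n 8 8)))))))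
    (trans (cong (take 9) (drop-seg (k * 8) r (16 ∸ r)))
      -- An offset of at most 7 leaves at least nine of the sixteen letters.
      (take-seg (r + k * 8) (∸-monoʳ-≤ 16 (≤-pred (toℕ<n ρ)))))

-- Conditions at the two ends and assembly of the word.

-- Positions 1, 2 and 3 have fewer than four letters on their left, so the centred window does not
-- fit. The repeated `x` encodes two equal neighbours in `T`.
GoodStart : ℕ → Bool → Set
GoodStart r x = ∀ (j : Fin 3) → ContainsOverlap (del (suc (toℕ j)) (drop r (blocks x x)))

goodStart? : ∀ r x → Dec (GoodStart r x)
goodStart? r x = allFin? λ j → containsOverlap? (del (suc (toℕ j)) (drop r (blocks x x)))

-- The last three interior positions, counted from the right: the final letter sits at `7 + s`. Here
-- the neighbours in `T` differ.
GoodEnd : ℕ → Bool → Set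
GoodEnd s x = ∀ (j : Fin 3) → ContainsOverlap (del (6 + s ∸ toℕ j) (take (8 + s) (blocks x (not x))))

goodEnd? : ∀ s x → Dec (GoodEnd s x)
goodEnd? s x = allFin? λ j → containsOverlap? (del (6 + s ∸ toℕ j) (take (8 + s) (blocks x (not x))))

-- The word starts at position r + 8k, with p letters left in that block of length 8, and ends s letters
-- after the start of block k + f + 2.
realisable : ∀ r s → (∀ x → GoodStart r x) → (∀ x → GoodEnd s x) → ∀ p f → r + p ≡ 8 → s ≤ 8 →
             Realisable (p + (8 + s) + f * 8)
-- Taking distance `suc f` puts the equal neighbours at the first block and the unequal ones at the
-- last full block `k'`.
realisable r s start end p f r+p≡8 s≤8 with stays-and-changes (suc f) (s≤s z≤n)
... | k , stay , change =
  seg i n , irreducible⁺ (seg-overlapFree i n) long dels , trans (length-seg i n) (swap p f s)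
  where
  swap : ∀ p f s → p + f * 8 + (8 + s) ≡ p + (8 + s) + f * 8
  swap = solve-∀

  i = r + k * 8
  N = p + f * 8
  n = N + (8 + s)
  k' = k + suc f

  long : length (seg i n) ≥ 3
  long = subst (3 ≤_) (sym (length-seg i n)) (m≤n⇒m≤o+n N (m≤m+n 3 (5 + s)))

  startWindow : drop r (blocks (T k) (T k)) ≡ seg i (8 + p)
  startWindow = trans (cong (λ y → drop r (blocks (T k) y)) (sym stay))
    (trans (cong (drop r) (trans (sym (seg-blocks k)) (cong (λ m → seg (k * 8) (8 + m)) (sym r+p≡8))))
    (trans (cong (λ m → drop r (seg (k * 8) m)) (shift r p)) (drop-seg (k * 8) r (8 + p))))
    where
    shift : ∀ r p → 8 + (r + p) ≡ r + (8 + p)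
    shift = solve-∀

  atStart : (j : Fin 3) → ContainsOverlap (del (suc (toℕ j)) (seg i n))
  -- The window of `8 + p` letters fits even for `f` zero, since `8 + s` letters follow the first
  -- `N`.
  atStart j = subst (λ m → ContainsOverlap (del (suc (toℕ j)) (seg i m))) (split p (f * 8) s)
    (del-window i 0 (8 + p) (f * 8 + s) (s≤s (≤-trans (toℕ<n j) (m≤m+n 3 (4 + p))))
      (subst (λ w → ContainsOverlap (del (suc (toℕ j)) w)) startWindow (start (T k) j)))
    where
    split : ∀ p g s → 8 + p + (g + s) ≡ p + g + (8 + s)
    split = solve-∀

  N+i≡k'*8 : N + i ≡ k' * 8
  N+i≡k'*8 = trans (gather p f r k) (trans (cong (_+ (f * 8 + k * 8)) r+p≡8) (total f k))
    where
    gather : ∀ p f r k → p + f * 8 + (r + k * 8) ≡ r + p + (f * 8 + k * 8)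
    gather = solve-∀
    total : ∀ f k → 8 + (f * 8 + k * 8) ≡ (k + suc f) * 8
    total = solve-∀

  endWindow : take (8 + s) (blocks (T k') (not (T k'))) ≡ seg (N + i) (8 + s)
  endWindow = trans (cong (λ y → take (8 + s) (blocks (T k') y)) (sym change))
    (trans (cong (take (8 + s)) (sym (seg-blocks k')))
    (trans (take-seg (k' * 8) (+-monoʳ-≤ 8 s≤8)) (cong (λ q → seg q (8 + s)) (sym N+i≡k'*8))))

  atEnd : (j : Fin 3) → ContainsOverlap (del (N + (6 + s ∸ toℕ j)) (seg i n))
  atEnd j = subst (λ m → ContainsOverlap (del (N + (6 + s ∸ toℕ j)) (seg i (N + m)))) (+-identityʳ (8 + s))
    (del-window i N (8 + s) 0 (s≤s (≤-trans (m∸n≤m (6 + s) (toℕ j)) (n≤1+n (6 + s))))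
      (subst (λ w → ContainsOverlap (del (6 + s ∸ toℕ j) w)) endWindow (end (T k') j)))

  -- At least four letters remain on either side, so the nine-letter window applies.
  inside : ∀ a b → 4 + a + suc (4 + b) ≡ n → ContainsOverlap (del (4 + a) (seg i n))
  inside a b eq = subst (λ m → ContainsOverlap (del m (seg i n))) (+-comm a 4)
    (subst (λ m → ContainsOverlap (del (a + 4) (seg i m))) (trans (split a b) eq)
      (del-window i a 9 b (m≤m+n 5 4) (seg-middle (a + i))))
    where
    split : ∀ a b → a + (9 + b) ≡ 4 + a + suc (4 + b)
    split = solve-∀

  dels : ∀ a b → suc a + suc (suc b) ≡ length (seg i n) → ContainsOverlap (del (suc a) (seg i n))
  dels 0 _ _ = atStart 0F
  dels 1 _ _ = atStart 1F
  dels 2 _ _ = atStart 2F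
  dels (suc (suc (suc a))) b eq = fromEnd b (trans eq (length-seg i n))
    where
    -- Matches a position counted from the left with one counted from the right: `c` letters remain,
    -- the deleted one included.
    position : ∀ b c → 4 + a + c ≡ n → N + b + c ≡ n → N + b ≡ 4 + a
    position b c eq eq' = +-cancelʳ-≡ c (N + b) (4 + a) (trans eq' (sym eq))
    end₀ : ∀ N s → N + (6 + s) + 2 ≡ N + (8 + s)
    end₀ = solve-∀
    end₁ : ∀ N s → N + (5 + s) + 3 ≡ N + (8 + s)
    end₁ = solve-∀
    end₂ : ∀ N s → N + (4 + s) + 4 ≡ N + (8 + s)
    end₂ = solve-∀
    fromEnd : ∀ b → 4 + a + suc (suc b) ≡ n → ContainsOverlap (del (4 + a) (seg i n))
    fromEnd 0 eq = subst (λ m → ContainsOverlap (del m (seg i n))) (position (6 + s) 2 eq (end₀ N s)) (atEnd 0F)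
    fromEnd 1 eq = subst (λ m → ContainsOverlap (del m (seg i n))) (position (5 + s) 3 eq (end₁ N s)) (atEnd 1F)
    fromEnd 2 eq = subst (λ m → ContainsOverlap (del m (seg i n))) (position (4 + s) 4 eq (end₂ N s)) (atEnd 2F)
    fromEnd (suc (suc (suc b))) eq = inside a b eq

-- Finite checks of the end conditions and the lengths realised.

goodStart-0 : ∀ x → GoodStart 0 x
goodStart-0 true  = from-yes (goodStart? 0 true)
goodStart-0 false = from-yes (goodStart? 0 false)

goodStart-3 : ∀ x → GoodStart 3 x
goodStart-3 true  = from-yes (goodStart? 3 true)
goodStart-3 false = from-yes (goodStart? 3 false)

goodStart-4 : ∀ x → GoodStart 4 x
goodStart-4 true  = from-yes (goodStart? 4 true)
goodStart-4 false = from-yes (goodStart? 4 false)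

goodStart-7 : ∀ x → GoodStart 7 x
goodStart-7 true  = from-yes (goodStart? 7 true)
goodStart-7 false = from-yes (goodStart? 7 false)

goodEnd-0 : ∀ x → GoodEnd 0 x
goodEnd-0 true  = from-yes (goodEnd? 0 true)
goodEnd-0 false = from-yes (goodEnd? 0 false)

goodEnd-6 : ∀ x → GoodEnd 6 x
goodEnd-6 true  = from-yes (goodEnd? 6 true)
goodEnd-6 false = from-yes (goodEnd? 6 false)

realisable-6 : Realisable 6
realisable-6 = _ , from-yes (irreducible?
  (false ∷ true ∷ false ∷ false ∷ true ∷ false ∷ [])) , refl

realisable-8 : Realisable 8
realisable-8 = _ , from-yes (irreducible?
  (false ∷ true ∷ true ∷ false ∷ true ∷ false ∷ false ∷ true ∷ [])) , refl

realisable-9 : Realisable 9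
realisable-9 = _ , from-yes (irreducible?
  (false ∷ true ∷ false ∷ false ∷ true ∷ false ∷ true ∷ true ∷ false ∷ [])) , refl

realisable-10 : Realisable 10
realisable-10 = _ , from-yes (irreducible?
  (false ∷ true ∷ false ∷ false ∷ true ∷ false ∷ true ∷ true ∷ false ∷ true ∷ [])) , refl

-- The combination used for lengths 6 modulo 8, with `r` zero and `s` six, starts only at 22.
realisable-14 : Realisable 14
realisable-14 = _ , from-yes (irreducible?
  (false ∷ true ∷ false ∷ true ∷ true ∷ false ∷ false ∷ true ∷
   true ∷ false ∷ true ∷ false ∷ false ∷ true ∷ [])) , refl

-- The sums `p + (8 + s)` with `p` in {1, 4, 5, 8} and `s` in {0, 6} hit each residue modulo 8 once;
-- `f` supplies the multiples of 8.
realisable-12+ : ∀ m → Realisable (12 + m)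
realisable-12+ m with m divMod 8
... | result f       0F refl = realisable 4 0 goodStart-4 goodEnd-0 4 f refl z≤n
... | result f       1F refl = realisable 3 0 goodStart-3 goodEnd-0 5 f refl z≤n
... | result zero    2F refl = realisable-14
... | result (suc f) 2F refl = realisable 0 6 goodStart-0 goodEnd-6 8 f refl (m≤m+n 6 2)
... | result f       3F refl = realisable 7 6 goodStart-7 goodEnd-6 1 f refl (m≤m+n 6 2)
... | result f       4F refl = realisable 0 0 goodStart-0 goodEnd-0 8 f refl z≤n
-- This combination starts at length 9, hence `suc f` to begin at 17.
... | result f       5F refl = realisable 7 0 goodStart-7 goodEnd-0 1 (suc f) refl z≤n
... | result f       6F refl = realisable 4 6 goodStart-4 goodEnd-6 4 f refl (m≤m+n 6 2)
... | result f       7F refl = realisable 3 6 goodStart-3 goodEnd-6 5 f refl (m≤m+n 6 2)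

theorem1 : (n : ℕ) →
    (∃ λ w → IrreducibleOverlapFree w × length w ≡ n) ⇔
    (n ≡ 6 ⊎ n ≡ 8 ⊎ n ≡ 9 ⊎ n ≡ 10 ⊎ n ≥ 12)
theorem1 n = mk⇔ (to n) (from n)
  where
  to : ∀ n → Realisable n → n ≡ 6 ⊎ n ≡ 8 ⊎ n ≡ 9 ⊎ n ≡ 10 ⊎ n ≥ 12
  to 0  r = contradiction r (¬realisable (from-yes (noIrreducible? 0)))
  to 1  r = contradiction r (¬realisable (from-yes (noIrreducible? 1)))
  to 2  r = contradiction r (¬realisable (from-yes (noIrreducible? 2)))
  to 3  r = contradiction r (¬realisable (from-yes (noIrreducible? 3)))
  to 4  r = contradiction r (¬realisable (from-yes (noIrreducible? 4)))
  to 5  r = contradiction r (¬realisable (from-yes (noIrreducible? 5)))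
  to 6  _ = inj₁ refl
  to 7  r = contradiction r (¬realisable (from-yes (noIrreducible? 7)))
  to 8  _ = inj₂ (inj₁ refl)
  to 9  _ = inj₂ (inj₂ (inj₁ refl))
  to 10 _ = inj₂ (inj₂ (inj₂ (inj₁ refl)))
  to 11 r = contradiction r (¬realisable (from-yes (noIrreducible? 11)))
  to (suc (suc (suc (suc (suc (suc (suc (suc (suc (suc (suc (suc m)))))))))))) _ =
    inj₂ (inj₂ (inj₂ (inj₂ (m≤m+n 12 m))))

  from : ∀ n → n ≡ 6 ⊎ n ≡ 8 ⊎ n ≡ 9 ⊎ n ≡ 10 ⊎ n ≥ 12 → Realisable n
  from _ (inj₁ refl)                      = realisable-6
  from _ (inj₂ (inj₁ refl))               = realisable-8
  from _ (inj₂ (inj₂ (inj₁ refl)))        = realisable-9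
  from _ (inj₂ (inj₂ (inj₂ (inj₁ refl)))) = realisable-10
  from n (inj₂ (inj₂ (inj₂ (inj₂ n≥12)))) =
    subst Realisable (m+[n∸m]≡n n≥12) (realisable-12+ (n ∸ 12))
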